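{- Let $\mathcal{G}=([n],E)$ be a simple graph, let $\mathcal{D}=\{S\subseteq[n] : \{i,j\}\in E \text{ for all distinct } i,j\in S\}$ be the downset of all cliques of $\mathcal{G}$, and let $G$ be a subgroup of the automorphism group of $\mathcal{G}$. Let $\mathcal{F}\subseteq\mathcal{D}$ be a family of feasible subsets (an antichain), and assume that each feasible $S\in\mathcal{F}$ is a maximal clique in $\mathcal{G}$ (not necessarily vice versa). Let $H$ be a subgroup of the symmetric group $\mathrm{Sym}(n)$ and let $\mathcal{G}_H$ be the $H$-compatibility graph of $\mathcal{G}$. Let $S$ be a feasible subset of pairwise $H$-compatible elements. Then $S$ is an $H$-invariant feasible subset. In particular, the algorithm symmetric lexicographic subset reverse search for feasible subsets, applied to the downset $\mathcal{D}_H$ of all cliques of the $H$-compatibility graph $\mathcal{G}_H$ with unaltered feasibility check, enumerates all $H$-invariant feasible subsets of $\mathcal{D}$ up to $H$-feasible symmetries.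
   Context: Notation: $[n]=\{1,\dots,n\}$; permutations in $\mathrm{Sym}(n)$ act on subsets of $[n]$ elementwise; the $H$-orbit of $i$ is $Hi=\{h(i):h\in H\}$. Elements $i,j$ with $\{i,j\}\in E$ are compatible. A subset $S\in\mathcal{D}$ is $H$-invariant if $h(S)=S$ for each $h\in H$. An element $i\in[n]$ is $H$-feasible if its $H$-orbit is a clique in $\mathcal{G}$, i.e., for each $h\in H$ either $h(i)=i$ or $\{h(i),i\}\in E$. Two $H$-feasible elements $i,j$ are $H$-compatible if the union of their $H$-orbits is a clique in $\mathcal{G}$, i.e., for each $h\in H$ and all $k,\ell\in Hi\cup Hj$ either $h(k)=\ell$ or $\{h(k),\ell\}\in E$. (A set of pairwise $H$-compatible elements consists of $H$-feasible elements.) The $H$-compatibility graph $\mathcal{G}_H$ has as nodes the $H$-feasible elements and as edges the $\{i,j\}\in E$ such that $i$ and $j$ are $H$-compatible. A permutation $g\in G$ is $H$-feasible (an $H$-feasible symmetry) if for all $i\in[n]$: $g(i)$ is $H$-feasible if and only if $i$ is $H$-feasible. Lexicographic order on subsets of $[n]$: $\emptyset\prec S$ for all $S\ne\emptyset$; for non-empty $S,R$, $S\prec R$ iff $\min S<\min R$, or $\min S=\min R$ and $S\setminus\{\min S\}\prec R\setminus\{\min R\}$. A subset is canonical if it is lexicographically minimal in its orbit under the given symmetry group. $S'$ lex-contains $S$ if $S\subseteq S'$ and every element of $S'\setminus S$ is larger than every element of $S$. The algorithm (for a downset, a family of feasible subsets, and a symmetry group) is the following recursion, started at $S=\emptyset$: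 if $S$ is feasible, output $S$ and return. Otherwise, for each $j>\max S$ (in increasing order) such that $S\cup\{j\}$ is in the downset, put $S'=S\cup\{j\}$; skip $S'$ if it is not lexicographically minimal in its orbit; skip $S'$ if a (correct but possibly incomplete) test certifies that no feasible subset lex-contains $S'$; otherwise recurse on $S'$. (The loop may also be left early if it is certified that no further expansion can lead to a feasible subset.) Enumerating a family up to a group of symmetries means outputting exactly one (the canonical) representative of each orbit.
   Formalization: One representative per orbit is proved only if H-feasible symmetries map H-invariant feasible subsets to such subsets (it can fail otherwise, e.g. on a 4-cycle); in general the output is shown to be exactly the canonical H-invariant feasible subsets, without repetition. -}

module Defs where

open import Data.Bool.Base using (Bool; true; if_then_else_; _∧_; not)
open import Data.Fin.Base using (Fin; zero; suc; _<_; _≤_; punchIn; punchOut)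
open import Data.Fin.Permutation
  using (Permutation′; _⟨$⟩ʳ_; _⟨$⟩ˡ_; _≈_; id; flip; _∘ₚ_; insert; remove; insert-remove; inverseˡ; inverseʳ)
open import Data.Fin.Properties using (_≟_; _<?_; any?; all?)
open import Data.Fin.Subset using (Subset; _∈_; _∉_; _⊆_; _∪_; ⁅_⁆; ⊥)
open import Data.Fin.Subset.Properties using (_∈?_)
open import Data.List.Base using (List; []; _∷_; [_]; _++_; filter; allFin)
open import Data.List.Membership.Propositional using () renaming (_∈_ to _∈ˡ_)
open import Data.List.Relation.Binary.Lex.Strict using (Lex-<; <-decidable)
open import Data.List.Relation.Unary.Unique.Propositional using (Unique)
open import Data.Nat.Base using (ℕ; zero; suc)
open import Data.Product.Base using (∃; _×_; _,_; proj₁; proj₂)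
open import Data.Vec.Base using (tabulate; lookup)
open import Data.Vec.Properties using (tabulate-cong)
open import Function.Base using (_∘_)
open import Function.Bundles using (_⇔_; mk⇔; module Equivalence)
open import Level using (0ℓ)
open import Relation.Binary.Core using (Rel)
open import Relation.Binary.Definitions using (Symmetric; Irreflexive; _Respects_)
  renaming (Decidable to Decidable₂)
open import Relation.Binary.PropositionalEquality
  using (_≡_; _≢_; refl; sym; trans; cong; subst)
open import Relation.Nullary using (¬_; Dec; yes; no; does; ¬?; _×-dec_; _→-dec_; _⊎-dec_)
open import Relation.Nullary.Decidable using (map′; decidable-stable)
open import Relation.Unary using (Pred; Decidable) renaming (_∪_ to _∪ᵖ_)

private
  variable
    n : ℕ

-- Quantification over Sym(n) is decidable, for properties that depend only on
-- the underlying function of a permutation.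

private
  insert-cong : ∀ i j {π ρ : Permutation′ n} → π ≈ ρ → insert i j π ≈ insert i j ρ
  insert-cong i j π≈ρ k with i ≟ k
  ... | yes _   = refl
  ... | no i≢k  = cong (punchIn j) (π≈ρ (punchOut i≢k))

any-perm? : {P : Pred (Permutation′ n) 0ℓ} → P Respects _≈_ → Decidable P → Dec (∃ P)
any-perm? {n = zero}  resp P? =
  map′ (λ p → id , p) (λ { (π , p) → resp (λ ()) p }) (P? id)
any-perm? {n = suc n} resp P? =
  map′ (λ { (j , π , p) → insert zero j π , p })
       (λ { (π , p) → π ⟨$⟩ʳ zero , remove zero π ,
                      resp (λ k → sym (insert-remove zero π k)) p })
       (any? λ j → any-perm? (λ π≈ρ → resp (insert-cong zero j π≈ρ))
                             (λ π → P? (insert zero j π)))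

all-perm? : {P : Pred (Permutation′ n) 0ℓ} → P Respects _≈_ → Decidable P → Dec (∀ π → P π)
all-perm? resp P? =
  map′ (λ ¬∃¬p π → decidable-stable (P? π) (λ ¬p → ¬∃¬p (π , ¬p)))
       (λ { ∀p (π , ¬p) → ¬p (∀p π) })
       (¬? (any-perm? (λ π≈ρ ¬p p → ¬p (resp (sym ∘ π≈ρ) p)) (λ π → ¬? (P? π))))

record Subgroup (n : ℕ) : Set₁ where
  infix 4 _∈ᴳ _∈ᴳ?
  field
    _∈ᴳ       : Pred (Permutation′ n) 0ℓ
    _∈ᴳ?      : Decidable _∈ᴳ
    respects  : _∈ᴳ Respects _≈_
    id-closed : id ∈ᴳ
    ∘-closed  : ∀ {π ρ} → π ∈ᴳ → ρ ∈ᴳ → (π ∘ₚ ρ) ∈ᴳ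
    ⁻¹-closed : ∀ {π} → π ∈ᴳ → flip π ∈ᴳ

open Subgroup using (_∈ᴳ; _∈ᴳ?; respects; id-closed; ∘-closed; ⁻¹-closed)

infix 4 _∈ˢ_
_∈ˢ_ : Permutation′ n → Subgroup n → Set
g ∈ˢ G = _∈ᴳ G g

-- j ∈ g(S) iff g⁻¹(j) ∈ S.
image : Permutation′ n → Subset n → Subset n
image g S = tabulate (λ j → lookup S (g ⟨$⟩ˡ j))

OrbitOf : Subgroup n → Fin n → Pred (Fin n) 0ℓ
OrbitOf H i k = ∃ λ h → h ∈ˢ H × h ⟨$⟩ʳ i ≡ k

SetOrbitOf : Subgroup n → Subset n → Pred (Subset n) 0ℓ
SetOrbitOf G S T = ∃ λ g → g ∈ˢ G × image g S ≡ T

Invariant : Subgroup n → Pred (Subset n) 0ℓ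
Invariant H S = ∀ h → h ∈ˢ H → image h S ≡ S

orbitOf? : (H : Subgroup n) (i : Fin n) → Decidable (OrbitOf H i)
orbitOf? H i k =
  any-perm? (λ { π≈ρ (π∈H , eq) → respects H π≈ρ π∈H , trans (sym (π≈ρ i)) eq })
            (λ h → _∈ᴳ? H h ×-dec (h ⟨$⟩ʳ i) ≟ k)

record SimpleGraph (n : ℕ) : Set₁ where
  infix 4 _~_ _~?_
  field
    _~_    : Rel (Fin n) 0ℓ
    _~?_   : Decidable₂ _~_
    sym~   : Symmetric _~_
    irrefl : Irreflexive _≡_ _~_

PairwiseDistinct : Rel (Fin n) 0ℓ → Pred (Fin n) 0ℓ → Set
PairwiseDistinct R P = ∀ k l → P k → P l → k ≢ l → R k l

pairwiseDistinct? : {R : Rel (Fin n) 0ℓ} {P : Pred (Fin n) 0ℓ} →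
                    Decidable₂ R → Decidable P → Dec (PairwiseDistinct R P)
pairwiseDistinct? R? P? =
  all? λ k → all? λ l → P? k →-dec P? l →-dec ¬? (k ≟ l) →-dec R? k l

module _ (Γ : SimpleGraph n) where
  open SimpleGraph Γ

  IsAutomorphism : Pred (Permutation′ n) 0ℓ
  IsAutomorphism g = ∀ i j → i ~ j ⇔ (g ⟨$⟩ʳ i) ~ (g ⟨$⟩ʳ j)

  -- On arbitrary predicates, so that it applies to orbits as well as to Subsets.
  IsClique : Pred (Fin n) 0ℓ → Set
  IsClique = PairwiseDistinct _~_

  Cliques : Pred (Subset n) 0ℓ
  Cliques S = IsClique (_∈ S)

  MaximalClique : Pred (Subset n) 0ℓ
  MaximalClique S = Cliques S × (∀ T → Cliques T → S ⊆ T → T ≡ S)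

  module _ (H : Subgroup n) where

    Feasible : Pred (Fin n) 0ℓ
    Feasible i = IsClique (OrbitOf H i)

    Compatible : Rel (Fin n) 0ℓ
    Compatible i j = Feasible i × Feasible j × IsClique (OrbitOf H i ∪ᵖ OrbitOf H j)

    -- The case i = j is included; it says that i is feasible.
    PairwiseCompatible : Pred (Subset n) 0ℓ
    PairwiseCompatible S = ∀ i j → i ∈ S → j ∈ S → Compatible i j

    -- The compatibility graph: its nodes are the feasible elements.
    CompatibilityEdge : Rel (Fin n) 0ℓ
    CompatibilityEdge i j = i ~ j × Compatible i j

    CompatibilityCliques : Pred (Subset n) 0ℓ
    CompatibilityCliques S =
      (∀ i → i ∈ S → Feasible i) × PairwiseDistinct CompatibilityEdge (_∈ S)

    feasible? : Decidable Feasible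
    feasible? i = pairwiseDistinct? _~?_ (orbitOf? H i)

    compatible? : Decidable₂ Compatible
    compatible? i j =
      feasible? i ×-dec feasible? j ×-dec
      pairwiseDistinct? _~?_ (λ k → orbitOf? H i k ⊎-dec orbitOf? H j k)

    compatibilityCliques? : Decidable CompatibilityCliques
    compatibilityCliques? S =
      (all? λ i → (i ∈? S) →-dec feasible? i) ×-dec
      pairwiseDistinct? (λ i j → (i ~? j) ×-dec compatible? i j) (_∈? S)

    FeasiblePermutation : Pred (Permutation′ n) 0ℓ
    FeasiblePermutation g = ∀ i → Feasible (g ⟨$⟩ʳ i) ⇔ Feasible i

    feasibleSymmetries : Subgroup n → Subgroup n
    feasibleSymmetries G = record
      { _∈ᴳ       = λ g → g ∈ˢ G × FeasiblePermutation g
      ; _∈ᴳ?      = λ g → _∈ᴳ? G g ×-dec all? λ i →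
                      map′ (λ { (f , t) → mk⇔ f t }) (λ e → to e , from e)
                        ((feasible? (g ⟨$⟩ʳ i) →-dec feasible? i) ×-dec
                         (feasible? i →-dec feasible? (g ⟨$⟩ʳ i)))
      ; respects  = λ { π≈ρ (π∈G , fp) → respects G π≈ρ π∈G ,
                      λ i → subst (λ x → Feasible x ⇔ Feasible i) (π≈ρ i) (fp i) }
      ; id-closed = id-closed G , λ i → mk⇔ (λ p → p) (λ p → p)
      ; ∘-closed  = λ { {π} {ρ} (π∈G , fp) (ρ∈G , fq) → ∘-closed G π∈G ρ∈G ,
                      λ i → mk⇔ (to (fp i) ∘ to (fq (π ⟨$⟩ʳ i)))
                                (from (fq (π ⟨$⟩ʳ i)) ∘ from (fp i)) }
      ; ⁻¹-closed = λ { {π} (π∈G , fp) → ⁻¹-closed G π∈G , λ i →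
                      mk⇔ (λ p → subst Feasible (inverseʳ π) (from (fp (π ⟨$⟩ˡ i)) p))
                          (λ p → to (fp (π ⟨$⟩ˡ i)) (subst Feasible (sym (inverseʳ π)) p)) }
      }
      where open Equivalence using (to; from)

Antichain : Pred (Subset n) 0ℓ → Set
Antichain ℱ = ∀ S T → ℱ S → ℱ T → S ⊆ T → S ≡ T

-- Lexicographic order: the head of the increasing list of elements of S is
-- min S, and its tail lists S ∖ {min S}.

elements : Subset n → List (Fin n)
elements S = filter (_∈? S) (allFin _)

infix 4 _≺_ _≺?_
_≺_ : Rel (Subset n) 0ℓ
S ≺ R = Lex-< _≡_ _<_ (elements S) (elements R)

_≺?_ : Decidable₂ (_≺_ {n})
S ≺? R = <-decidable _≟_ _<?_ (elements S) (elements R)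

Canonical : Subgroup n → Pred (Subset n) 0ℓ
Canonical K S = ∀ T → SetOrbitOf K S T → ¬ T ≺ S

private
  from-cong : {π ρ : Permutation′ n} → π ≈ ρ → ∀ i → π ⟨$⟩ˡ i ≡ ρ ⟨$⟩ˡ i
  from-cong {π = π} {ρ} π≈ρ i =
    trans (cong (π ⟨$⟩ˡ_) (trans (sym (inverseʳ ρ)) (sym (π≈ρ (ρ ⟨$⟩ˡ i)))))
          (inverseˡ π)

  image-cong : {π ρ : Permutation′ n} (S : Subset n) → π ≈ ρ → image π S ≡ image ρ S
  image-cong {π = π} {ρ} S π≈ρ =
    tabulate-cong λ i → cong (lookup S) (from-cong {π = π} {ρ} π≈ρ i)

canonical? : (K : Subgroup n) → Decidable (Canonical K)
canonical? K S =
  map′ (λ { c T (g , g∈K , refl) → c g g∈K })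
       (λ c g g∈K → c (image g S) (g , g∈K , refl))
       (all-perm?
         (λ {π} {ρ} π≈ρ p ρ∈K ρS≺S → p (respects K (sym ∘ π≈ρ) ρ∈K)
            (subst (_≺ S) (sym (image-cong {π = π} {ρ} S π≈ρ)) ρS≺S))
         (λ g → _∈ᴳ? K g →-dec ¬? (image g S ≺? S)))

LexContains : Subset n → Subset n → Set
LexContains T S = S ⊆ T × (∀ x y → x ∈ T → x ∉ S → y ∈ S → y < x)

-- Arbitrary correct, possibly incomplete tests for a downset 𝒟 and a family ℱ
-- of feasible subsets.  `skip S′` discards S′; `leave S j` leaves the loop at S
-- before j is tried.

record Tests (𝒟 ℱ : Pred (Subset n) 0ℓ) : Set where
  field
    skip          : Subset n → Bool
    skip-correct  : ∀ S′ → skip S′ ≡ true →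
                    ∀ T → 𝒟 T → ℱ T → ¬ LexContains T S′
    leave         : Subset n → Fin n → Bool
    leave-correct : ∀ S j → leave S j ≡ true →
                    ∀ k → j ≤ k → (∀ i → i ∈ S → i < k) →
                    ∀ T → 𝒟 T → ℱ T → ¬ LexContains T (S ∪ ⁅ k ⁆)

-- Symmetric lexicographic subset reverse search.  The list argument of `search`
-- is the increasing list of all j > max S: initially S is empty and the list is
-- that of all elements, and after extending S by j the list continues with the
-- elements following j.

module _ {𝒟 ℱ : Pred (Subset n) 0ℓ} (𝒟? : Decidable 𝒟) (ℱ? : Decidable ℱ)
         (K : Subgroup n) (tests : Tests 𝒟 ℱ) where
  open Tests tests

  mutual
    search : Subset n → List (Fin n) → List (Subset n)
    search S js = if does (ℱ? S) then [ S ] else loop S js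

    loop : Subset n → List (Fin n) → List (Subset n)
    loop S []       = []
    loop S (j ∷ js) =
      if leave S j then [] else
      (let S′ = S ∪ ⁅ j ⁆ in
       (if does (𝒟? S′) ∧ does (canonical? K S′) ∧ not (skip S′)
        then search S′ js else [])
       ++ loop S js)

  reverseSearch : List (Subset n)
  reverseSearch = search ⊥ (allFin n)

-- If K does not act on 𝒜, the lexicographic minimum of the K-orbit of a member of
-- 𝒜 may lie outside 𝒜, and then that orbit has no canonical representative in 𝒜.
ActsOn : Subgroup n → Pred (Subset n) 0ℓ → Set
ActsOn K 𝒜 = ∀ g → g ∈ˢ K → ∀ S → 𝒜 S → 𝒜 (image g S)

record EnumeratesUpTo (K : Subgroup n) (𝒜 : Pred (Subset n) 0ℓ)
                      (output : List (Subset n)) : Set where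
  field
    no-repetition  : Unique output
    canonical      : ∀ R → R ∈ˡ output → 𝒜 R × Canonical K R
    representative : ∀ S → 𝒜 S → ∃ λ R → R ∈ˡ output × SetOrbitOf K S R ×
                     (∀ R′ → R′ ∈ˡ output → SetOrbitOf K S R′ → R′ ≡ R)

{-# OPTIONS --safe #-}

-- If S is a maximal clique of pairwise H-compatible elements and h ∈ H, then h(j) is
-- equal or adjacent to every i ∈ S, so h(j) ∈ S by maximality; hence h(S) = S.
-- Conversely the orbits of the elements of an invariant clique stay inside it, so the
-- invariant feasible sets are exactly the feasible cliques of the compatibility graph.
--
-- The search finds every canonical feasible R because each R reaches it through its
-- initial segments: these are cliques, they are not feasible (antichain), no correct
-- test discards them, and they are canonical: if g(P) ≺ P for an initial segment P of R,
-- then g(R), which contains g(P), is already smaller than R within its first ∣P∣ elements.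

module Submission where

open import Defs
open import Data.Bool.Base using (Bool; true; false; if_then_else_; _∧_; not)
open import Data.Fin.Base using (Fin; _<_; _≤_)
open import Data.Fin.Permutation
  using (Permutation′; _⟨$⟩ʳ_; _⟨$⟩ˡ_; _≈_; id; flip; _∘ₚ_; inverseˡ; inverseʳ)
open import Data.Fin.Properties using (_≟_; <-cmp; <-trans; <-irrefl; <-asym; ≤-refl)
open import Data.Fin.Induction using (<-wellFounded)
open import Data.Fin.Subset using (Subset; _⊆_; _∪_; ⁅_⁆; ⊥) renaming (_∈_ to _∈ₛ_; _∉_ to _∉ₛ_)
open import Data.Fin.Subset.Properties
  using (_∈?_; ⊆-antisym; p⊆p∪q; x∈p∪q⁻; x∈p∪q⁺; x∈⁅x⁆; x∈⁅y⁆⇒x≡y; ∉⊥; ⊥⊆)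
open import Data.List.Base using (List; []; _∷_; _++_; filter; length; map; allFin)
open import Data.List.Membership.Propositional using (_∈_)
open import Data.List.Membership.Propositional.Properties
  using (∈-filter⁺; ∈-filter⁻; ∈-allFin; ∈-map⁺; ∈-map⁻; ∈-++⁺ˡ; ∈-++⁺ʳ)
open import Data.List.Membership.Propositional.Properties.WithK using (unique∧set⇒bag)
open import Data.List.Properties using (filter-none; length-filter; length-map; length-tabulate)
open import Data.List.Relation.Binary.BagAndSetEquality using (∼bag⇒↭)
open import Data.List.Relation.Binary.Lex.Strict using (Lex-<; halt; this; next; xs≮[]; <-compare)
open import Data.List.Relation.Binary.Permutation.Propositional.Properties using (↭-length)
open import Data.List.Relation.Binary.Pointwise using (Pointwise-≡⇒≡)
open import Data.List.Relation.Binary.Prefix.Heterogeneous using (Prefix; []; _∷_)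
open import Data.List.Relation.Binary.Subset.Propositional using () renaming (_⊆_ to _⊆ˡ_)
open import Data.List.Relation.Unary.All as All using (All; []; _∷_)
import Data.List.Relation.Unary.All.Properties as All
open import Data.List.Relation.Unary.AllPairs using (AllPairs; []; _∷_)
import Data.List.Relation.Unary.AllPairs.Properties as AllPairs
open import Data.List.Relation.Unary.Any using (here; there)
open import Data.List.Relation.Unary.Unique.Propositional using (Unique)
import Data.List.Relation.Unary.Unique.Propositional.Properties as Unique
open import Data.Nat.Base as ℕ using (ℕ; suc)
import Data.Nat.Properties as ℕ
open import Data.Product.Base using (∃; _×_; _,_; proj₁; proj₂)
open import Data.Sum.Base as Sum using (_⊎_; inj₁; inj₂)
open import Data.Vec.Base using (lookup)
open import Data.Vec.Properties
  using (tabulate-cong; tabulate∘lookup; lookup∘tabulate; []=⇒lookup; lookup⇒[]=)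
open import Function.Base using (_∘_; case_of_)
open import Function.Bundles using (_⇔_; mk⇔; module Equivalence)
open import Induction.WellFounded using (Acc; acc)
open import Level using (0ℓ)
open import Relation.Binary.Definitions using (tri<; tri≈; tri>)
open import Relation.Binary.PropositionalEquality
  using (_≡_; _≢_; refl; sym; trans; cong; subst)
open import Relation.Nullary using (¬_; Dec; yes; no; does; contradiction; _×-dec_)
open import Relation.Unary using (Pred; Decidable)

open Subgroup using (_∈ᴳ?; respects; id-closed; ∘-closed; ⁻¹-closed)

private
  variable
    n : ℕ

-- Lexicographic order on lists: extension and well-foundedness.

infix 4 _<ₗ_
_<ₗ_ : List (Fin n) → List (Fin n) → Set
_<ₗ_ = Lex-< _≡_ _<_

-- Equal lengths rule out that `ys` is a proper prefix of `xs`, so the two differ at some position.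
-- As both lists increase, the extra members of `ys′` can only lower the entry at that position or
-- at an earlier one.
<ₗ-extend : {xs ys xs′ ys′ : List (Fin n)} → AllPairs _<_ ys → AllPairs _<_ ys′ →
            ys ⊆ˡ ys′ → length ys ≡ length xs → Prefix _≡_ xs xs′ →
            ys <ₗ xs → ys′ <ₗ xs′
<ₗ-extend {ys′ = []} _ _ ys⊆ _ _ (this _) = case ys⊆ (here refl) of λ ()
<ₗ-extend {ys′ = []} _ _ ys⊆ _ _ (next _ _) = case ys⊆ (here refl) of λ ()
<ₗ-extend {ys′ = z ∷ zs} _ (z< ∷ _) ys⊆ _ (refl ∷ _) (this y<x) with ys⊆ (here refl)
... | here refl = this y<x
... | there y∈zs = this (<-trans (All.lookup z< y∈zs) y<x)
<ₗ-extend {ys′ = z ∷ zs} (y< ∷ incr) (z< ∷ incr′) ys⊆ len (refl ∷ pre) (next refl ys<xs)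
  with ys⊆ (here refl)
... | there y∈zs = this (All.lookup z< y∈zs)
... | here refl = next refl (<ₗ-extend incr incr′ tail⊆ (ℕ.suc-injective len) pre ys<xs)
  where
  tail⊆ : _ ⊆ˡ zs
  tail⊆ v∈ys with ys⊆ (there v∈ys)
  ... | here refl  = contradiction (All.lookup y< v∈ys) (<-irrefl refl)
  ... | there v∈zs = v∈zs

-- The length bound is needed: without it [1] > [0,1] > [0,0,1] > … descends forever.
<ₗ-bounded-acc : ∀ k (xs : List (Fin n)) → length xs ℕ.≤ k →
                 Acc (λ ys zs → length ys ℕ.≤ k × ys <ₗ zs) xs
<ₗ-bounded-acc k [] _ = acc λ { (_ , lt) → contradiction lt xs≮[] }
<ₗ-bounded-acc {n} (suc k) (x ∷ xs) (ℕ.s≤s xs≤k) =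
  go (<-wellFounded x) (<ₗ-bounded-acc k xs xs≤k)
  where
  _⊏[_]_ : List (Fin n) → ℕ → List (Fin n) → Set
  ys ⊏[ m ] zs = length ys ℕ.≤ m × ys <ₗ zs

  mutual
    go : ∀ {x xs} → Acc _<_ x → Acc (λ ys zs → ys ⊏[ k ] zs) xs →
         Acc (λ ys zs → ys ⊏[ suc k ] zs) (x ∷ xs)
    go ax axs = acc (below ax axs)

    below : ∀ {x xs} → Acc _<_ x → Acc (λ ys zs → ys ⊏[ k ] zs) xs →
            ∀ {ys} → ys ⊏[ suc k ] (x ∷ xs) → Acc (λ ys zs → ys ⊏[ suc k ] zs) ys
    below _        _         (_ , halt)                 = acc λ { (_ , lt) → contradiction lt xs≮[] }
    -- A smaller head allows an arbitrary tail, whose accessibility comes afresh from the smaller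
    -- length bound `k`.
    below (acc rx) _         (ℕ.s≤s len , this y<x)     = go (rx y<x) (<ₗ-bounded-acc k _ len)
    below ax       (acc rxs) (ℕ.s≤s len , next refl lt) = go ax (rxs (len , lt))

-- Subsets as increasing lists.

elements⁺ : {S : Subset n} {x : Fin n} → x ∈ₛ S → x ∈ elements S
elements⁺ {S = S} = ∈-filter⁺ (_∈? S) (∈-allFin _)

elements⁻ : {S : Subset n} {x : Fin n} → x ∈ elements S → x ∈ₛ S
elements⁻ {S = S} = proj₂ ∘ ∈-filter⁻ (_∈? S) {xs = allFin _}

elements-mono : {S T : Subset n} → S ⊆ T → elements S ⊆ˡ elements T
elements-mono S⊆T = elements⁺ ∘ S⊆T ∘ elements⁻

elements-injective : {S T : Subset n} → elements S ≡ elements T → S ≡ T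
elements-injective eq =
  ⊆-antisym (elements⁻ ∘ subst (_ ∈_) eq ∘ elements⁺)
            (elements⁻ ∘ subst (_ ∈_) (sym eq) ∘ elements⁺)

allFin-increasing : ∀ n → AllPairs _<_ (allFin n)
allFin-increasing n = AllPairs.tabulate⁺-< λ i<j → i<j

elements-increasing : (S : Subset n) → AllPairs _<_ (elements S)
elements-increasing S = AllPairs.filter⁺ (_∈? S) (allFin-increasing _)

elements-unique : (S : Subset n) → Unique (elements S)
elements-unique S = Unique.filter⁺ (_∈? S) (Unique.allFin⁺ _)

length-elements : (S : Subset n) → length (elements S) ℕ.≤ n
length-elements {n} S =
  ℕ.≤-trans (length-filter (_∈? S) (allFin n)) (ℕ.≤-reflexive (length-tabulate {n = n} _))

elements-⊥ : elements (⊥ {n}) ≡ []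
elements-⊥ {n} = filter-none (_∈? ⊥) {xs = allFin n} (All.universal (λ _ → ∉⊥) _)

-- Both sides filter the same increasing enumeration. They agree up to the first element of `T`
-- outside `S`, and beyond it `S` has no elements left.
lexContains⇒prefix : {S T : Subset n} → LexContains T S →
                     Prefix _≡_ (elements S) (elements T)
lexContains⇒prefix {n} {S} {T} (S⊆T , above) = go (allFin-increasing n)
  where
  go : ∀ {xs} → AllPairs _<_ xs → Prefix _≡_ (filter (_∈? S) xs) (filter (_∈? T) xs)
  go [] = []
  go {x ∷ xs} (x< ∷ incr) with x ∈? S | x ∈? T
  ... | yes _   | yes _   = refl ∷ go incr
  ... | yes x∈S | no x∉T  = contradiction (S⊆T x∈S) x∉T
  ... | no _    | no _    = go incr
  ... | no x∉S  | yes x∈T = subst (λ ys → Prefix _≡_ ys _) (sym (filter-none (_∈? S) none)) []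
    where
    none : All (_∉ₛ S) xs
    none = All.map (λ x<y y∈S → <-asym x<y (above x _ x∈T x∉S y∈S)) x<

-- Images of subsets under permutations.

∈-image⁺ : (g : Permutation′ n) {S : Subset n} {x : Fin n} →
           x ∈ₛ S → g ⟨$⟩ʳ x ∈ₛ image g S
∈-image⁺ g {S} {x} x∈S = lookup⇒[]= _ _
  (trans (lookup∘tabulate _ (g ⟨$⟩ʳ x))
         (trans (cong (lookup S) (inverseˡ g)) ([]=⇒lookup x∈S)))

∈-image⁻ : (g : Permutation′ n) {S : Subset n} {y : Fin n} →
           y ∈ₛ image g S → g ⟨$⟩ˡ y ∈ₛ S
∈-image⁻ g {S} {y} y∈gS = lookup⇒[]= _ _
  (trans (sym (lookup∘tabulate _ y)) ([]=⇒lookup y∈gS))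

image-mono : (g : Permutation′ n) {S T : Subset n} → S ⊆ T → image g S ⊆ image g T
image-mono g S⊆T y∈gS =
  subst (_∈ₛ _) (inverseʳ g) (∈-image⁺ g (S⊆T (∈-image⁻ g y∈gS)))

image-cong-⊆ : {π ρ : Permutation′ n} (S : Subset n) → π ≈ ρ → image π S ⊆ image ρ S
image-cong-⊆ {π = π} {ρ} S π≈ρ y∈πS =
  subst (_∈ₛ image ρ S) (trans (sym (π≈ρ _)) (inverseʳ π)) (∈-image⁺ ρ (∈-image⁻ π {S} y∈πS))

image-cong : {π ρ : Permutation′ n} (S : Subset n) → π ≈ ρ → image π S ≡ image ρ S
image-cong {π = π} {ρ} S π≈ρ =
  ⊆-antisym (image-cong-⊆ {π = π} {ρ} S π≈ρ) (image-cong-⊆ {π = ρ} {π} S (sym ∘ π≈ρ))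

image-∘ : (π ρ : Permutation′ n) (S : Subset n) → image (π ∘ₚ ρ) S ≡ image ρ (image π S)
image-∘ π ρ S = tabulate-cong λ j → sym (lookup∘tabulate _ (ρ ⟨$⟩ˡ j))

image-flip : (g : Permutation′ n) (S : Subset n) → image (flip g) (image g S) ≡ S
image-flip g S = trans (tabulate-cong λ j → trans (lookup∘tabulate _ (g ⟨$⟩ʳ j))
                                                  (cong (lookup S) (inverseˡ g)))
                       (tabulate∘lookup S)

-- Mapping `g` over `elements S` gives a list with the same members as `elements (image g S)`, in
-- general unsorted. Both are free of duplicates, so each is a rearrangement of the other.
length-elements-image : (g : Permutation′ n) (S : Subset n) →
                        length (elements (image g S)) ≡ length (elements S)
length-elements-image g S = trans
  (↭-length (∼bag⇒↭ (unique∧set⇒bag (elements-unique (image g S))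
    (Unique.map⁺ g-injective (elements-unique S)) (mk⇔ to from))))
  (length-map (g ⟨$⟩ʳ_) (elements S))
  where
  g-injective : ∀ {x y} → g ⟨$⟩ʳ x ≡ g ⟨$⟩ʳ y → x ≡ y
  g-injective eq = trans (sym (inverseˡ g)) (trans (cong (g ⟨$⟩ˡ_) eq) (inverseˡ g))

  to : elements (image g S) ⊆ˡ map (g ⟨$⟩ʳ_) (elements S)
  to y∈ = subst (_∈ _) (inverseʳ g)
    (∈-map⁺ (g ⟨$⟩ʳ_) (elements⁺ (∈-image⁻ g (elements⁻ y∈))))

  from : map (g ⟨$⟩ʳ_) (elements S) ⊆ˡ elements (image g S)
  from y∈ with x , x∈ , refl ← ∈-map⁻ (g ⟨$⟩ʳ_) y∈ = elements⁺ (∈-image⁺ g (elements⁻ x∈))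

-- Orbits of subsets and their canonical representatives.

module _ (K : Subgroup n) where

  orbit-refl : ∀ S → SetOrbitOf K S S
  orbit-refl S = id , id-closed K , tabulate∘lookup S

  orbit-sym : ∀ S {T} → SetOrbitOf K S T → SetOrbitOf K T S
  orbit-sym S (g , g∈K , refl) = flip g , ⁻¹-closed K g∈K , image-flip g S

  orbit-trans : ∀ S {T U} → SetOrbitOf K S T → SetOrbitOf K T U → SetOrbitOf K S U
  orbit-trans S (g , g∈K , refl) (h , h∈K , refl) = g ∘ₚ h , ∘-closed K g∈K h∈K , image-∘ g h S

  canonical-⊥ : Canonical K ⊥
  canonical-⊥ T _ T≺⊥ = xs≮[] (subst (elements T <ₗ_) elements-⊥ T≺⊥)

  -- This makes pruning at non-canonical sets safe: a `g` that lowers `S` also lowers `T`.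
  canonical-lexContained : ∀ {S T} → LexContains T S → Canonical K T → Canonical K S
  canonical-lexContained {S} {T} T⊒S can _ (g , g∈K , refl) gS≺S =
    can (image g T) (g , g∈K , refl)
      (<ₗ-extend (elements-increasing (image g S)) (elements-increasing (image g T))
        (elements-mono (image-mono g (proj₁ T⊒S))) (length-elements-image g S)
        (lexContains⇒prefix T⊒S) gS≺S)

  canonical-unique : ∀ {S T} → Canonical K S → Canonical K T → SetOrbitOf K S T → S ≡ T
  canonical-unique {S} {T} canS canT T∈KS
    with <-compare sym <-cmp (elements S) (elements T)
  ... | tri< S≺T _ _ = contradiction S≺T (canT S (orbit-sym S T∈KS))
  ... | tri≈ _ eq _  = elements-injective (Pointwise-≡⇒≡ eq)
  ... | tri> _ _ T≺S = contradiction T≺S (canS T T∈KS)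

  -- Descent through strictly smaller images: whether one exists is decidable by `any-perm?`, and
  -- the descent stops because all element lists have length at most `n`.
  canonical-representative : ∀ S → ∃ λ R → SetOrbitOf K S R × Canonical K R
  canonical-representative S = go S (<ₗ-bounded-acc n (elements S) (length-elements S))
    where
    go : ∀ S → Acc (λ ys zs → length ys ℕ.≤ n × ys <ₗ zs) (elements S) →
         ∃ λ R → SetOrbitOf K S R × Canonical K R
    go S (acc rec) with any-perm? {P = λ g → g ∈ˢ K × image g S ≺ S}
      (λ {π} {ρ} π≈ρ (π∈K , lt) → respects K π≈ρ π∈K ,
                                  subst (_≺ S) (image-cong {π = π} {ρ} S π≈ρ) lt)
      (λ g → _∈ᴳ? K g ×-dec image g S ≺? S)
    ... | no ¬smaller = S , orbit-refl S , λ { _ (g , g∈K , refl) lt → ¬smaller (g , g∈K , lt) }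
    ... | yes (g , g∈K , lt) =
      let R , R∈KgS , can = go (image g S) (rec (length-elements (image g S) , lt))
      in R , orbit-trans S (g , g∈K , refl) R∈KgS , can

-- Adding one element, and case distinctions for the loop.

∪⁅⁆⁻ : (S : Subset n) {x j : Fin n} → x ∈ₛ S ∪ ⁅ j ⁆ → x ∈ₛ S ⊎ x ≡ j
∪⁅⁆⁻ S {j = j} = Sum.map₂ (x∈⁅y⁆⇒x≡y j) ∘ x∈p∪q⁻ S ⁅ j ⁆

j∈∪⁅j⁆ : (S : Subset n) (j : Fin n) → j ∈ₛ S ∪ ⁅ j ⁆
j∈∪⁅j⁆ S j = x∈p∪q⁺ (inj₂ (x∈⁅x⁆ j))

∪⁅⁆⊆ : {S T : Subset n} {j : Fin n} → S ⊆ T → j ∈ₛ T → S ∪ ⁅ j ⁆ ⊆ T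
∪⁅⁆⊆ {S = S} S⊆T j∈T x∈ with ∪⁅⁆⁻ S x∈
... | inj₁ x∈S  = S⊆T x∈S
... | inj₂ refl = j∈T

-- Needed for early exits from the loop: the next element of `R` to be added need not be the head of
-- `js`.
leastMember : (R : Subset n) {js : List (Fin n)} → AllPairs _<_ js →
              All (_∉ₛ R) js ⊎
              ∃ λ k → k ∈ js × k ∈ₛ R × (∀ x → x ∈ js → x ∈ₛ R → x ≢ k → k < x)
leastMember R [] = inj₁ []
leastMember R {j ∷ js} (j< ∷ incr) with j ∈? R | leastMember R incr
... | yes j∈R | _ = inj₂ (j , here refl , j∈R , λ where
  x (here refl)  _ x≢j → contradiction refl x≢j
  x (there x∈js) _ _   → All.lookup j< x∈js)
... | no j∉R | inj₁ none = inj₁ (j∉R ∷ none)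
... | no j∉R | inj₂ (k , k∈js , k∈R , least) = inj₂ (k , there k∈js , k∈R , λ where
  x (here refl)  x∈R _   → contradiction x∈R j∉R
  x (there x∈js) x∈R x≢k → least x x∈js x∈R x≢k)

-- The three ways of being rejected are merged into one negated conjunction, so that a single
-- argument deals with all of them.
if-accepted : {A B X : Set} (a? : Dec A) (b? : Dec B) (rejected : Bool)
              (P : List X → Set) {xs : List X} →
              (A → B → P xs) → (¬ (A × B × rejected ≢ true) → P []) →
              P (if does a? ∧ does b? ∧ not rejected then xs else [])
if-accepted (yes a) (yes b) false _ t _ = t a b
if-accepted (yes _) (yes _) true  _ _ e = e λ (_ , _ , r) → r refl
if-accepted (yes _) (no ¬b) _     _ _ e = e λ (_ , b , _) → ¬b b
if-accepted (no ¬a) _       _     _ _ e = e λ (a , _) → ¬a a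

-- Soundness of the search and absence of repetitions.

module _ {𝒟 ℱ : Pred (Subset n) 0ℓ} (𝒟? : Decidable 𝒟) (ℱ? : Decidable ℱ)
         (K : Subgroup n) (tests : Tests 𝒟 ℱ) where
  open Tests tests

  -- The invariant of every output of a search at `S` with remaining candidates `js`. The fields
  -- `extends` and `within` serve to show that different branches have disjoint outputs.
  record Found (S : Subset n) (js : List (Fin n)) (R : Subset n) : Set where
    constructor found
    field
      member    : 𝒟 R × ℱ R
      canonical : Canonical K R
      extends   : S ⊆ R
      within    : ∀ {x} → x ∈ₛ R → x ∈ₛ S ⊎ x ∈ js

  found-skip : ∀ {S j js R} → Found S js R → Found S (j ∷ js) R
  found-skip (found m c e w) = found m c e (Sum.map₂ there ∘ w)

  found-take : ∀ {S j js R} → Found (S ∪ ⁅ j ⁆) js R → Found S (j ∷ js) R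
  found-take {S} {j} (found m c e w) = found m c (e ∘ p⊆p∪q ⁅ j ⁆) λ x∈R → case w x∈R of λ where
    (inj₂ x∈js) → inj₂ (there x∈js)
    (inj₁ x∈S′) → Sum.map₂ here (∪⁅⁆⁻ S x∈S′)

  -- Goals about loop normalise to the unfolding of canonical?, on which `with` does not
  -- match; hence the detour through if-accepted, where the decisions are variables.
  loop-step : ∀ S j js (P : List (Subset n) → Set) →
    (leave S j ≡ true → P []) →
    (𝒟 (S ∪ ⁅ j ⁆) → Canonical K (S ∪ ⁅ j ⁆) →
      P (search 𝒟? ℱ? K tests (S ∪ ⁅ j ⁆) js ++ loop 𝒟? ℱ? K tests S js)) →
    (¬ (𝒟 (S ∪ ⁅ j ⁆) × Canonical K (S ∪ ⁅ j ⁆) × skip (S ∪ ⁅ j ⁆) ≢ true) →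
      P (loop 𝒟? ℱ? K tests S js)) →
    P (loop 𝒟? ℱ? K tests S (j ∷ js))
  loop-step S j js P left taken skipped with leave S j
  ... | true  = left refl
  ... | false = if-accepted (𝒟? (S ∪ ⁅ j ⁆)) (canonical? K (S ∪ ⁅ j ⁆)) (skip (S ∪ ⁅ j ⁆))
                  (λ Rs → P (Rs ++ loop 𝒟? ℱ? K tests S js)) taken skipped

  mutual
    search-sound : ∀ S js → 𝒟 S → Canonical K S →
                   All (Found S js) (search 𝒟? ℱ? K tests S js)
    search-sound S js dS cS with ℱ? S
    ... | yes fS = found (dS , fS) cS (λ x∈S → x∈S) inj₁ ∷ []
    ... | no _   = loop-sound S js

    loop-sound : ∀ S js → All (Found S js) (loop 𝒟? ℱ? K tests S js)
    loop-sound S [] = []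
    loop-sound S (j ∷ js) = loop-step S j js (All (Found S (j ∷ js)))
      (λ _ → [])
      (λ d c → All.++⁺ (All.map found-take (search-sound (S ∪ ⁅ j ⁆) js d c))
                       (All.map found-skip (loop-sound S js)))
      (λ _ → All.map found-skip (loop-sound S js))

  mutual
    search-unique : ∀ S js → AllPairs _<_ js → All (_∉ₛ S) js →
                    Unique (search 𝒟? ℱ? K tests S js)
    search-unique S js incr js∉S with ℱ? S
    ... | yes _ = [] ∷ []
    ... | no _  = loop-unique S js incr js∉S

    loop-unique : ∀ S js → AllPairs _<_ js → All (_∉ₛ S) js →
                  Unique (loop 𝒟? ℱ? K tests S js)
    loop-unique S [] _ _ = []
    loop-unique S (j ∷ js) (j< ∷ incr) (j∉S ∷ js∉S) = loop-step S j js Unique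
      (λ _ → [])
      (λ d c → Unique.++⁺ (search-unique (S ∪ ⁅ j ⁆) js incr js∉S′) (loop-unique S js incr js∉S)
        -- Outputs of the branch that takes `j` contain `j`; outputs of the rest of the loop do not,
        -- since `j` is neither in `S` nor in `js`.
        λ (R∈ , R∈′) →
          let j∈R = Found.extends (All.lookup (search-sound (S ∪ ⁅ j ⁆) js d c) R∈) (j∈∪⁅j⁆ S j)
          in case Found.within (All.lookup (loop-sound S js) R∈′) j∈R of λ where
               (inj₁ j∈S)  → j∉S j∈S
               (inj₂ j∈js) → <-irrefl refl (All.lookup j< j∈js))
      (λ _ → loop-unique S js incr js∉S)
      where
      js∉S′ : All (_∉ₛ S ∪ ⁅ j ⁆) js
      js∉S′ = All.zipWith (λ (j<x , x∉S) x∈S′ → case ∪⁅⁆⁻ S x∈S′ of λ where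
        (inj₁ x∈S)  → x∉S x∈S
        (inj₂ refl) → <-irrefl refl j<x) (j< , js∉S)

  -- Completeness: the path of the search to a canonical feasible set.

  module _ (𝒟-down : ∀ S T → 𝒟 T → S ⊆ T → 𝒟 S) (antichain : Antichain ℱ)
           {R : Subset n} (dR : 𝒟 R) (fR : ℱ R) (cR : Canonical K R) where

    -- The search state `S`, `js` lies on the path to `R`: by `covers` and `below`, `S` is an
    -- initial segment of `R` and the rest of `R` is still among the candidates.
    record Leads (S : Subset n) (js : List (Fin n)) : Set where
      field
        S⊆R    : S ⊆ R
        covers : ∀ x → x ∈ₛ R → x ∈ₛ S ⊎ x ∈ js
        below  : ∀ i → i ∈ₛ S → All (i <_) js
        incr   : AllPairs _<_ js

    -- Any further element of `R` is a candidate, hence above `S` by `below` and above `k` by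
    -- `least`. The entry `k` is arbitrary rather than the head because an early exit concerns later
    -- candidates too.
    leads-least : ∀ {S js} → Leads S js → ∀ k → k ∈ js → k ∈ₛ R →
                  (∀ x → x ∈ js → x ∈ₛ R → x ≢ k → k < x) → LexContains R (S ∪ ⁅ k ⁆)
    leads-least {S} {js} leads k k∈js k∈R least = ∪⁅⁆⊆ S⊆R k∈R , above
      where
      open Leads leads
      above : ∀ x y → x ∈ₛ R → x ∉ₛ S ∪ ⁅ k ⁆ → y ∈ₛ S ∪ ⁅ k ⁆ → y < x
      above x y x∈R x∉S′ y∈S′ with covers x x∈R
      ... | inj₁ x∈S = contradiction (p⊆p∪q ⁅ k ⁆ x∈S) x∉S′
      ... | inj₂ x∈js with ∪⁅⁆⁻ S y∈S′
      ... | inj₁ y∈S  = All.lookup (below y y∈S) x∈js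
      ... | inj₂ refl = least x x∈js x∈R λ { refl → x∉S′ (j∈∪⁅j⁆ S k) }

    leads-head : ∀ {S j js} → Leads S (j ∷ js) → j ∈ₛ R → LexContains R (S ∪ ⁅ j ⁆)
    leads-head {j = j} leads j∈R with Leads.incr leads
    ... | j< ∷ _ = leads-least leads j (here refl) j∈R λ where
      x (here refl)  _ x≢j → contradiction refl x≢j
      x (there x∈js) _ _   → All.lookup j< x∈js

    leads-take : ∀ {S j js} → Leads S (j ∷ js) → j ∈ₛ R → Leads (S ∪ ⁅ j ⁆) js
    leads-take {S} {j} leads j∈R with Leads.incr leads
    ... | j< ∷ incr′ = record
      { S⊆R    = ∪⁅⁆⊆ S⊆R j∈R
      ; covers = λ x x∈R → case covers x x∈R of λ where
          (inj₁ x∈S)          → inj₁ (p⊆p∪q ⁅ j ⁆ x∈S)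
          (inj₂ (here refl))  → inj₁ (j∈∪⁅j⁆ S j)
          (inj₂ (there x∈js)) → inj₂ x∈js
      ; below  = λ i i∈S′ → case ∪⁅⁆⁻ S i∈S′ of λ where
          (inj₁ i∈S)  → All.tail (below i i∈S)
          (inj₂ refl) → j<
      ; incr   = incr′
      }
      where open Leads leads

    leads-skip : ∀ {S j js} → Leads S (j ∷ js) → j ∉ₛ R → Leads S js
    leads-skip leads j∉R with Leads.incr leads
    ... | _ ∷ incr′ = record
      { S⊆R    = S⊆R
      ; covers = λ x x∈R → case covers x x∈R of λ where
          (inj₁ x∈S)          → inj₁ x∈S
          (inj₂ (here refl))  → contradiction x∈R j∉R
          (inj₂ (there x∈js)) → inj₂ x∈js
      ; below  = λ i i∈S → All.tail (below i i∈S)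
      ; incr   = incr′
      }
      where open Leads leads

    leads-done : ∀ {S js} → Leads S js → All (_∉ₛ R) js → ℱ S
    leads-done {S} leads none = subst ℱ (⊆-antisym R⊆S S⊆R) fR
      where
      open Leads leads
      R⊆S : R ⊆ S
      R⊆S {x} x∈R with covers x x∈R
      ... | inj₁ x∈S  = x∈S
      ... | inj₂ x∈js = contradiction x∈R (All.lookup none x∈js)

    -- A correct exit before `j` denies every continuation by some `k` with `j ≤ k`, yet the least
    -- candidate in `R` is such a continuation. If no candidate is in `R`, then `S` is `R` and
    -- already feasible.
    leads-stays : ∀ {S j js} → Leads S (j ∷ js) → ¬ ℱ S → leave S j ≢ true
    leads-stays {S} {j} leads ¬fS leaves with leastMember R (Leads.incr leads)
    ... | inj₁ none = ¬fS (leads-done leads none)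
    ... | inj₂ (k , k∈ , k∈R , least) =
      leave-correct S j leaves k (j≤ k∈ (Leads.incr leads))
        (λ i i∈S → All.lookup (Leads.below leads i i∈S) k∈) R dR fR
        (leads-least leads k k∈ k∈R least)
      where
      j≤ : ∀ {j js} → k ∈ j ∷ js → AllPairs _<_ (j ∷ js) → j ≤ k
      j≤ (here refl)  _        = ≤-refl
      j≤ (there k∈js) (j< ∷ _) = ℕ.<⇒≤ (All.lookup j< k∈js)

    mutual
      search-complete : ∀ S js → Leads S js → R ∈ search 𝒟? ℱ? K tests S js
      search-complete S js leads with ℱ? S
      -- The search stops with `S` as its only output; a feasible set inside `R` is `R` itself.
      ... | yes fS = here (sym (antichain S R fS fR (Leads.S⊆R leads)))
      ... | no ¬fS = loop-complete S js leads ¬fS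

      loop-complete : ∀ S js → Leads S js → ¬ ℱ S → R ∈ loop 𝒟? ℱ? K tests S js
      loop-complete S [] leads ¬fS = contradiction (leads-done leads []) ¬fS
      loop-complete S (j ∷ js) leads ¬fS = loop-step S j js (R ∈_)
        (λ leaves → contradiction leaves (leads-stays leads ¬fS))
        (λ _ _ → case j ∈? R of λ where
          (yes j∈R) → ∈-++⁺ˡ (search-complete (S ∪ ⁅ j ⁆) js (leads-take leads j∈R))
          (no j∉R)  → ∈-++⁺ʳ _ (loop-complete S js (leads-skip leads j∉R) ¬fS))
        (λ rejected → case j ∈? R of λ where
          -- The extension by `j` is an initial segment of `R`, so it passes each of the three
          -- checks.
          (yes j∈R) → let R⊒S′ = leads-head leads j∈R in contradiction
            ( 𝒟-down _ R dR (proj₁ R⊒S′) , canonical-lexContained K R⊒S′ cR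
            , λ skips → skip-correct _ skips R dR fR R⊒S′ ) rejected
          (no j∉R)  → loop-complete S js (leads-skip leads j∉R) ¬fS)

  reverseSearch-unique : Unique (reverseSearch 𝒟? ℱ? K tests)
  reverseSearch-unique =
    search-unique ⊥ (allFin n) (allFin-increasing n) (All.universal (λ _ → ∉⊥) _)

  reverseSearch-correct : 𝒟 ⊥ → (∀ S T → 𝒟 T → S ⊆ T → 𝒟 S) → Antichain ℱ →
    ∀ R → R ∈ reverseSearch 𝒟? ℱ? K tests ⇔ ((𝒟 R × ℱ R) × Canonical K R)
  reverseSearch-correct d⊥ down anti R = mk⇔
    (λ R∈ → let r = All.lookup (search-sound ⊥ (allFin n) d⊥ (canonical-⊥ K)) R∈
            in Found.member r , Found.canonical r)
    (λ ((dR , fR) , cR) → search-complete down anti dR fR cR ⊥ (allFin n) record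
      { S⊆R    = ⊥⊆
      ; covers = λ x _ → inj₂ (∈-allFin x)
      ; below  = λ i i∈⊥ → contradiction i∈⊥ ∉⊥
      ; incr   = allFin-increasing n
      })

-- From a list of canonical members to an enumeration of orbits.

enumeratesUpTo : (K : Subgroup n) {𝒜 : Pred (Subset n) 0ℓ} {output : List (Subset n)} →
                 Unique output → (∀ R → R ∈ output ⇔ (𝒜 R × Canonical K R)) →
                 ActsOn K 𝒜 → EnumeratesUpTo K 𝒜 output
enumeratesUpTo K {𝒜} {output} unique correct acts = record
  { no-repetition  = unique
  ; canonical      = λ R → to (correct R)
  ; representative = rep
  }
  where
  open Equivalence using (to; from)
  rep : ∀ S → 𝒜 S → ∃ λ R → R ∈ output × SetOrbitOf K S R ×
        (∀ R′ → R′ ∈ output → SetOrbitOf K S R′ → R′ ≡ R)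
  rep S aS with canonical-representative K S
  ... | R , (g , g∈K , refl) , can =
    -- `acts` keeps the canonical set `R` of the orbit inside `𝒜`, which puts it into the output.
    R , from (correct R) (acts g g∈K S aS , can) , (g , g∈K , refl) ,
    λ R′ R′∈ R′∈KS → canonical-unique K (proj₂ (to (correct R′) R′∈)) can
      (orbit-trans K R′ (orbit-sym K S R′∈KS) (g , g∈K , refl))

-- Invariant sets and cliques of the compatibility graph.

module _ (H : Subgroup n) where

  orbitOf-refl : ∀ i → OrbitOf H i i
  orbitOf-refl i = id , id-closed H , refl

  invariant-orbit : ∀ {S i k} → Invariant H S → i ∈ₛ S → OrbitOf H i k → k ∈ₛ S
  invariant-orbit inv i∈S (h , h∈H , refl) = subst (_ ∈ₛ_) (inv h h∈H) (∈-image⁺ h i∈S)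

  -- Closure under `h` gives `image h S ⊆ S`; closure under the inverse of `h` gives the other
  -- inclusion.
  orbit-closed⇒invariant : ∀ {S} → (∀ i k → i ∈ₛ S → OrbitOf H i k → k ∈ₛ S) → Invariant H S
  orbit-closed⇒invariant {S} closed h h∈H = ⊆-antisym
    (λ y∈hS → subst (_∈ₛ S) (inverseʳ h) (closed _ _ (∈-image⁻ h y∈hS) (h , h∈H , refl)))
    (λ y∈S → subst (_∈ₛ image h S) (inverseʳ h)
       (∈-image⁺ h (closed _ _ y∈S (flip h , ⁻¹-closed H h∈H , refl))))

module _ (Γ : SimpleGraph n) (H : Subgroup n) where
  open SimpleGraph Γ

  -- Adding `k` keeps the set a clique, so by maximality it adds nothing. The condition `i ≢ k`
  -- allows for `k` being in `S` from the start.
  maximal-member : ∀ {S k} → MaximalClique Γ S → (∀ i → i ∈ₛ S → i ≢ k → i ~ k) → k ∈ₛ S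
  maximal-member {S} {k} (clique , maximal) adjacent =
    subst (k ∈ₛ_) (maximal (S ∪ ⁅ k ⁆) clique′ (p⊆p∪q ⁅ k ⁆)) (j∈∪⁅j⁆ S k)
    where
    clique′ : Cliques Γ (S ∪ ⁅ k ⁆)
    clique′ i j i∈ j∈ i≢j with ∪⁅⁆⁻ S i∈ | ∪⁅⁆⁻ S j∈
    ... | inj₁ i∈S  | inj₁ j∈S  = clique i j i∈S j∈S i≢j
    ... | inj₁ i∈S  | inj₂ refl = adjacent i i∈S i≢j
    ... | inj₂ refl | inj₁ j∈S  = sym~ (adjacent j j∈S (i≢j ∘ sym))
    ... | inj₂ refl | inj₂ refl = contradiction refl i≢j

  pairwiseCompatible⇒invariant : ∀ S → MaximalClique Γ S → PairwiseCompatible Γ H S →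
                                 Invariant H S
  pairwiseCompatible⇒invariant S max compatible = orbit-closed⇒invariant H λ j k j∈S k∈Hj →
    maximal-member max λ i i∈S →
      -- The union of the orbits of `i` and `j` is a clique that contains `i`, through the identity,
      -- and `k`, as a member of the orbit of `j`.
      proj₂ (proj₂ (compatible i j i∈S j∈S)) i k (inj₁ (orbitOf-refl H i)) (inj₂ k∈Hj)

  compatibilityCliques⇒pairwiseCompatible : ∀ S → CompatibilityCliques Γ H S →
                                            PairwiseCompatible Γ H S
  compatibilityCliques⇒pairwiseCompatible S (feasible , edges) i j i∈S j∈S with i ≟ j
  ... | no i≢j   = proj₂ (edges i j i∈S j∈S i≢j)
  -- No edge joins `i` to itself; the node condition takes over, as the union of the orbit with
  -- itself is the orbit.
  ... | yes refl = feasible i i∈S , feasible i i∈S , λ k l k∈ l∈ →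
    feasible i i∈S k l (Sum.reduce k∈) (Sum.reduce l∈)

  invariant⇒compatibilityCliques : ∀ S → Cliques Γ S → Invariant H S →
                                   CompatibilityCliques Γ H S
  invariant⇒compatibilityCliques S clique inv = feasible , λ i j i∈S j∈S i≢j →
    clique i j i∈S j∈S i≢j , feasible i i∈S , feasible j j∈S ,
    λ k l k∈ l∈ → clique k l (orbits⊆S i∈S j∈S k∈) (orbits⊆S i∈S j∈S l∈)
    where
    feasible : ∀ i → i ∈ₛ S → Feasible Γ H i
    feasible i i∈S k l k∈Hi l∈Hi =
      clique k l (invariant-orbit H inv i∈S k∈Hi) (invariant-orbit H inv i∈S l∈Hi)

    orbits⊆S : ∀ {i j k} → i ∈ₛ S → j ∈ₛ S → OrbitOf H i k ⊎ OrbitOf H j k → k ∈ₛ S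
    orbits⊆S i∈S j∈S = Sum.[ invariant-orbit H inv i∈S , invariant-orbit H inv j∈S ]

  compatibilityCliques-⊥ : CompatibilityCliques Γ H ⊥
  compatibilityCliques-⊥ =
    (λ i i∈⊥ → contradiction i∈⊥ ∉⊥) , λ i j i∈⊥ _ _ → contradiction i∈⊥ ∉⊥

  compatibilityCliques-down : ∀ S T → CompatibilityCliques Γ H T → S ⊆ T →
                              CompatibilityCliques Γ H S
  compatibilityCliques-down S T (feasible , edges) S⊆T =
    (λ i i∈S → feasible i (S⊆T i∈S)) , λ i j i∈S j∈S → edges i j (S⊆T i∈S) (S⊆T j∈S)

theorem1 :
    (n : ℕ) (Γ : SimpleGraph n)
    (G : Subgroup n) → (∀ g → g ∈ˢ G → IsAutomorphism Γ g) →
    (ℱ : Pred (Subset n) 0ℓ) (ℱ? : Decidable ℱ) →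
    (∀ S → ℱ S → Cliques Γ S) →
    Antichain ℱ →
    (∀ S → ℱ S → MaximalClique Γ S) →
    (H : Subgroup n) →
    let K = feasibleSymmetries Γ H G
        InvariantFeasible : Pred (Subset n) 0ℓ
        InvariantFeasible = λ S → Invariant H S × ℱ S
    in
    (∀ S → ℱ S → PairwiseCompatible Γ H S → InvariantFeasible S)
    ×
    ((tests : Tests (CompatibilityCliques Γ H) ℱ) →
     let output = reverseSearch (compatibilityCliques? Γ H) ℱ? K tests in
     (Unique output × (∀ R → R ∈ output ⇔ (InvariantFeasible R × Canonical K R)))
     ×
     (ActsOn K InvariantFeasible → EnumeratesUpTo K InvariantFeasible output))
theorem1 n Γ G _ ℱ ℱ? ℱ-cliques antichain maximal H =
  invariantFeasible , λ tests →
    (unique tests , correct tests) , enumeratesUpTo K (unique tests) (correct tests)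
  where
  K : Subgroup n
  K = feasibleSymmetries Γ H G

  InvariantFeasible : Pred (Subset n) 0ℓ
  InvariantFeasible S = Invariant H S × ℱ S

  invariantFeasible : ∀ S → ℱ S → PairwiseCompatible Γ H S → InvariantFeasible S
  invariantFeasible S fS compatible =
    pairwiseCompatible⇒invariant Γ H S (maximal S fS) compatible , fS

  module _ (tests : Tests (CompatibilityCliques Γ H) ℱ) where
    output : List (Subset n)
    output = reverseSearch (compatibilityCliques? Γ H) ℱ? K tests

    unique : Unique output
    unique = reverseSearch-unique (compatibilityCliques? Γ H) ℱ? K tests

    correct : ∀ R → R ∈ output ⇔ (InvariantFeasible R × Canonical K R)
    correct R = mk⇔
      -- The search only guarantees a feasible clique of the compatibility graph; its invariance
      -- comes from the first half of the theorem.
      (λ R∈ → let (dR , fR) , cR = to found⇔ R∈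
              in invariantFeasible R fR (compatibilityCliques⇒pairwiseCompatible Γ H R dR) , cR)
      (λ ((inv , fR) , cR) →
        from found⇔ ((invariant⇒compatibilityCliques Γ H R (ℱ-cliques R fR) inv , fR) , cR))
      where
      open Equivalence using (to; from)
      found⇔ = reverseSearch-correct (compatibilityCliques? Γ H) ℱ? K tests
                 (compatibilityCliques-⊥ Γ H) (compatibilityCliques-down Γ H) antichain R
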